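{- Let $a$ be a nonzero color and let $C$ be a signed circle. Then $C$ has a proper edge coloring using only the colors $\pm a$ if and only if $C$ is positive. Furthermore, every positive signed circle has exactly two proper edge colorings using only the colors $\pm a$.
   Context: A signed graph is $\Sigma=(\Gamma,\sigma)$ with $\Gamma$ a finite simple graph and $\sigma:E(\Gamma)\to\{+,-\}$; a signed circle is one whose underlying graph is a cycle (connected and 2-regular), and it is positive if the product of its edge signs is $+$. An incidence is a pair $(v,e)$ with $v$ an endpoint of $e$. An edge coloring with colors from a set $S$ of signed colors (closed under negation) is a map $\gamma$ from incidences to $S$ with $\gamma(v,e)=-\sigma(e)\gamma(w,e)$ for each edge $e$ with endpoints $v,w$; it is proper if $\gamma(v,e)\neq\gamma(v,f)$ for distinct edges $e,f$ sharing an endpoint $v$. -}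

module Defs where

open import Data.Nat using (ℕ; _<ᵇ_; _<_)
open import Data.Fin using (Fin; toℕ)
open import Data.Bool using (Bool; true; false; _∧_; if_then_else_; T)
open import Data.List using (List; allFin; foldr)
open import Data.Sign using (Sign) renaming (_*_ to _·_)
open import Data.Integer using (ℤ; -_)
open import Data.Product using (Σ; ∃; ∃₂; _×_; _,_)
open import Data.Sum using (_⊎_)
open import Relation.Nullary using (¬_)
open import Relation.Binary.PropositionalEquality using (_≡_; _≢_)
open import Relation.Binary.Construct.Closure.ReflexiveTransitive using (Star)

-- A signed graph on the vertex set Fin n.
-- The underlying finite simple graph is given by a Boolean adjacency
-- relation that is symmetric and irreflexive; an edge is an unordered pair
-- {v , w} with adj v w ≡ true.  The signature σ assigns a sign to each
-- unordered pair (symmetric); only its values on edges matter.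
record SignedGraph (n : ℕ) : Set where
  field
    adj      : Fin n → Fin n → Bool
    adj-sym  : ∀ v w → adj v w ≡ adj w v
    adj-irr  : ∀ v → adj v v ≡ false
    σ        : Fin n → Fin n → Sign
    σ-sym    : ∀ v w → σ v w ≡ σ w v

open SignedGraph public

Adj : ∀ {n} → SignedGraph n → Fin n → Fin n → Set
Adj S v w = adj S v w ≡ true

-- Connected: nonempty, and any two vertices are joined by a walk.
Connected : ∀ {n} → SignedGraph n → Set
Connected {n} S = Fin n × (∀ u v → Star (Adj S) u v)

-- 2-regular: every vertex has exactly two neighbours.
TwoRegular : ∀ {n} → SignedGraph n → Set
TwoRegular {n} S = ∀ v → Σ (Fin n) λ w₁ → Σ (Fin n) λ w₂ →
  w₁ ≢ w₂ × Adj S v w₁ × Adj S v w₂ × (∀ u → Adj S v u → u ≡ w₁ ⊎ u ≡ w₂)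

-- A signed circle: the underlying graph is a cycle (connected and 2-regular).
IsCircle : ∀ {n} → SignedGraph n → Set
IsCircle S = Connected S × TwoRegular S

-- Product of the signs of all edges (each unordered edge {v,w} counted once,
-- via the ordered representative with toℕ v < toℕ w).
signProduct : ∀ {n} → SignedGraph n → Sign
signProduct {n} S =
  foldr (λ v acc → foldr (λ w acc' →
           if adj S v w ∧ (toℕ v <ᵇ toℕ w) then σ S v w · acc' else acc')
         acc (allFin n))
        Sign.+ (allFin n)

Positive : ∀ {n} → SignedGraph n → Set
Positive S = signProduct S ≡ Sign.+

-- Signed colours are integers (closed under negation -_); 0 is the
-- self-negative colour.  Acting by a sign on a colour:
_◃c_ : Sign → ℤ → ℤ
Sign.+ ◃c x = x
Sign.- ◃c x = - x

-- An incidence (v, e) with e = {v , w} is represented by the ordered pair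
-- (v , w) with Adj S v w; a colouring γ assigns γ v w to it (values of γ on
-- non-adjacent pairs are irrelevant).
Coloring : ℕ → Set
Coloring n = Fin n → Fin n → ℤ

-- Edge colouring condition: γ(v,e) = -σ(e) γ(w,e).
IsEdgeColoring : ∀ {n} → SignedGraph n → Coloring n → Set
IsEdgeColoring S γ = ∀ v w → Adj S v w → γ v w ≡ - (σ S v w ◃c γ w v)

-- Proper: distinct edges at a common vertex get distinct colours there.
IsProper : ∀ {n} → SignedGraph n → Coloring n → Set
IsProper S γ = ∀ v w₁ w₂ → Adj S v w₁ → Adj S v w₂ → w₁ ≢ w₂ → γ v w₁ ≢ γ v w₂

-- Uses only the colours ±a.
UsesOnly± : ∀ {n} → SignedGraph n → ℤ → Coloring n → Set
UsesOnly± S a γ = ∀ v w → Adj S v w → γ v w ≡ a ⊎ γ v w ≡ - a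

ProperColoring± : ∀ {n} → SignedGraph n → ℤ → Coloring n → Set
ProperColoring± S a γ = IsEdgeColoring S γ × IsProper S γ × UsesOnly± S a γ

-- Two colourings are the same iff they agree on every incidence.
SameColoring : ∀ {n} → SignedGraph n → Coloring n → Coloring n → Set
SameColoring S γ δ = ∀ v w → Adj S v w → γ v w ≡ δ v w

-- There are exactly two proper ±a colourings (as maps on incidences).
ExactlyTwo± : ∀ {n} → SignedGraph n → ℤ → Set
ExactlyTwo± {n} S a = Σ (Coloring n) λ γ₁ → Σ (Coloring n) λ γ₂ →
  ProperColoring± S a γ₁ × ProperColoring± S a γ₂ × ¬ SameColoring S γ₁ γ₂ ×
  (∀ γ → ProperColoring± S a γ → SameColoring S γ γ₁ ⊎ SameColoring S γ γ₂)

{-# OPTIONS --safe #-}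
module Submission where

open import Algebra.Bundles using (CommutativeMonoid)
import Algebra.Properties.CommutativeMonoid.Sum
open import Data.Bool using (Bool; true; false; T; _∧_; if_then_else_)
open import Data.Bool.Properties using (T-≡)
open import Data.Empty using (⊥; ⊥-elim)
open import Data.Fin as Fin using (Fin; toℕ; combine; punchIn; punchOut; fromℕ; fromℕ<)
open import Data.Fin.Properties
  using (toℕ-injective; punchInᵢ≢i; punchIn-injective; punchIn-punchOut; pigeonhole; combine-injective;
         ¬∀⟶∃¬-smallest; toℕ-fromℕ; toℕ-inject; toℕ-fromℕ<)
open import Data.Integer as ℤ using (ℤ; 0ℤ; -_)
open import Data.Integer.Properties using (neg-involutive)
open import Data.List using (foldr; tabulate)
open import Data.Nat using (ℕ; zero; suc; _+_; _*_; _∸_; _<_; _≤_; _<ᵇ_; s≤s; z≤n)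
open import Data.Nat.DivMod using (_%_; _/_; m%n<n; m≡m%n+[m/n]*n)
open import Data.Nat.Properties
  using (+-0-commutativeMonoid; +-identityʳ; +-suc; +-assoc; +-comm; *-cancelˡ-≡; <ᵇ⇒<; <⇒<ᵇ; <-asym; <-cmp;
         <⇒≤; ≤-refl; ≤-reflexive; ≤-trans; ≤-pred; m≤n+m; m+[n∸m]≡n; n<1+n; m≤n⇒m<n∨m≡n)
open import Data.Product using (Σ; ∃; _×_; _,_; proj₁; proj₂; uncurry)
open import Data.Sign as Sign using (Sign; opposite) renaming (_*_ to _·_)
open import Data.Sign.Properties
  using (*-commutativeMonoid; *-assoc; *-comm; *-identityʳ; s*s≡+; opposite[s]*s≡-; s≢opposite[s];
         opposite-involutive; opposite-injective)
open import Data.Sum using (_⊎_; inj₁; inj₂; [_,_]′)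
open import Data.Vec.Functional using (Vector; removeAt)
open import Function using (_∘_; id)
open import Function.Bundles using (_⇔_; mk⇔; Equivalence)
open import Relation.Binary.Construct.Closure.ReflexiveTransitive using (Star; fold; map)
open import Relation.Binary.Definitions using (tri<; tri≈; tri>)
open import Relation.Binary.PropositionalEquality
  using (_≡_; _≢_; refl; sym; trans; cong; cong₂; subst; subst₂; module ≡-Reasoning)
open import Relation.Nullary using (¬_; ¬?; Dec; does; yes; no)
open import Relation.Nullary.Decidable using (decidable-stable; _×-dec_; map′)
open import Relation.Unary using (Decidable)

open import Defs

-- A ±a-colouring is a sign s(v,w) at every incidence, with γ(v,w) = s(v,w)·a.  Properness says the
-- two signs at each vertex are opposite, and the edge condition says σ(vw) = −s(v,w)·s(w,v).
-- Multiplying the edge condition over all edges gives ∏σ = (−1)^|E| · ∏ᵥ(−1) = +, because a 2-regular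
-- graph has as many edges as vertices; so a colourable circle is positive.  Conversely, walking once
-- around the circle and propagating the edge condition from the start vertex yields signs that satisfy
-- it on every edge except the closing one, where they are off by the holonomy δ of the walk.  The same
-- product computation then gives ∏σ · δ = +, so δ = + on a positive circle.  Finally, two admissible
-- choices of signs differ at each vertex by a factor which the edge condition makes equal at adjacent
-- vertices, hence by one global sign: there are exactly two colourings.

minimal-witness : ∀ {p} {P : ℕ → Set p} → Decidable P → ∀ {m} → P m →
                  Σ ℕ λ k → P k × (∀ {j} → j < k → ¬ P j)
minimal-witness {P = P} P? {m} Pm
  with ¬∀⟶∃¬-smallest (suc m) (λ i → ¬ P (toℕ i)) (λ i → ¬? (P? (toℕ i)))
         (λ none → none (fromℕ m) (subst P (sym (toℕ-fromℕ m)) Pm))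
... | i , ¬¬Pi , below = toℕ i , decidable-stable (P? (toℕ i)) ¬¬Pi ,
      λ j<i → subst (λ j → ¬ P j) (trans (toℕ-inject (fromℕ< j<i)) (toℕ-fromℕ< j<i)) (below (fromℕ< j<i))

x≡opposite[y·z]⇒y≡opposite[x·z] : ∀ x y z → x ≡ opposite (y · z) → y ≡ opposite (x · z)
x≡opposite[y·z]⇒y≡opposite[x·z] _ Sign.- Sign.- refl = refl
x≡opposite[y·z]⇒y≡opposite[x·z] _ Sign.- Sign.+ refl = refl
x≡opposite[y·z]⇒y≡opposite[x·z] _ Sign.+ Sign.- refl = refl
x≡opposite[y·z]⇒y≡opposite[x·z] _ Sign.+ Sign.+ refl = refl

≢⇒≡opposite : ∀ {x y} → x ≢ y → x ≡ opposite y
≢⇒≡opposite {Sign.-} {Sign.-} x≢y = ⊥-elim (x≢y refl)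
≢⇒≡opposite {Sign.-} {Sign.+} _   = refl
≢⇒≡opposite {Sign.+} {Sign.-} _   = refl
≢⇒≡opposite {Sign.+} {Sign.+} x≢y = ⊥-elim (x≢y refl)

opposite[x]·opposite[y]≡x·y : ∀ x y → opposite x · opposite y ≡ x · y
opposite[x]·opposite[y]≡x·y Sign.- _ = refl
opposite[x]·opposite[y]≡x·y Sign.+ y = opposite-involutive y

[x·y]·y≡x : ∀ x y → (x · y) · y ≡ x
[x·y]·y≡x x y = trans (*-assoc x y y) (trans (cong (x ·_) (s*s≡+ y)) (*-identityʳ x))

x·y≡[p·x]·[q·y]⇒p≡q : ∀ p q x y → x · y ≡ (p · x) · (q · y) → p ≡ q
x·y≡[p·x]·[q·y]⇒p≡q Sign.+ Sign.+ _ _ _ = refl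
x·y≡[p·x]·[q·y]⇒p≡q Sign.- Sign.- _ _ _ = refl
x·y≡[p·x]·[q·y]⇒p≡q Sign.+ Sign.- Sign.+ Sign.+ ()
x·y≡[p·x]·[q·y]⇒p≡q Sign.+ Sign.- Sign.+ Sign.- ()
x·y≡[p·x]·[q·y]⇒p≡q Sign.+ Sign.- Sign.- Sign.+ ()
x·y≡[p·x]·[q·y]⇒p≡q Sign.+ Sign.- Sign.- Sign.- ()
x·y≡[p·x]·[q·y]⇒p≡q Sign.- Sign.+ Sign.+ Sign.+ ()
x·y≡[p·x]·[q·y]⇒p≡q Sign.- Sign.+ Sign.+ Sign.- ()
x·y≡[p·x]·[q·y]⇒p≡q Sign.- Sign.+ Sign.- Sign.+ ()
x·y≡[p·x]·[q·y]⇒p≡q Sign.- Sign.+ Sign.- Sign.- ()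

opposite[x·opposite[y]]≡x·y : ∀ x y → opposite (x · opposite y) ≡ x · y
opposite[x·opposite[y]]≡x·y Sign.+ y = opposite-involutive y
opposite[x·opposite[y]]≡x·y Sign.- y = opposite-involutive (opposite y)

y·[y·x]≡x : ∀ x y → y · (y · x) ≡ x
y·[y·x]≡x x y = trans (sym (*-assoc y y x)) (cong (_· x) (s*s≡+ y))

i≢0⇒i≢-i : ∀ {a} → a ≢ 0ℤ → a ≢ - a
i≢0⇒i≢-i {ℤ.+ zero}    a≢0 _ = a≢0 refl
i≢0⇒i≢-i {ℤ.+[1+ _ ]}  _   ()
i≢0⇒i≢-i {ℤ.-[1+ _ ]}  _   ()

◃c-injective : ∀ {a} → a ≢ 0ℤ → ∀ {s t} → s ◃c a ≡ t ◃c a → s ≡ t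
◃c-injective a≢0 {Sign.+} {Sign.+} _    = refl
◃c-injective a≢0 {Sign.-} {Sign.-} _    = refl
◃c-injective a≢0 {Sign.+} {Sign.-} a≡-a = ⊥-elim (i≢0⇒i≢-i a≢0 a≡-a)
◃c-injective a≢0 {Sign.-} {Sign.+} -a≡a = ⊥-elim (i≢0⇒i≢-i a≢0 (sym -a≡a))

neg-◃c-◃c : ∀ s t a → - (s ◃c (t ◃c a)) ≡ opposite (s · t) ◃c a
neg-◃c-◃c Sign.+ Sign.+ a = refl
neg-◃c-◃c Sign.+ Sign.- a = neg-involutive a
neg-◃c-◃c Sign.- Sign.+ a = neg-involutive a
neg-◃c-◃c Sign.- Sign.- a = cong -_ (neg-involutive a)

module ℕ-Sum = Algebra.Properties.CommutativeMonoid.Sum +-0-commutativeMonoid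

module FiniteSums {c ℓ} (M : CommutativeMonoid c ℓ) where

  open CommutativeMonoid M renaming (refl to ≈-refl; sym to ≈-sym; trans to ≈-trans)
  open import Algebra.Properties.CommutativeMonoid.Sum M public
  open import Algebra.Properties.Monoid.Mult monoid public using (×-homo-1; ×-homo-+)
    renaming (_×_ to _times_)
  open import Relation.Binary.Reasoning.Setoid setoid

  when : Bool → Carrier → Carrier
  when b x = if b then x else ε

  when-true : ∀ {b} x → b ≡ true → when b x ≈ x
  when-true x refl = ≈-refl

  sum-single : ∀ {n} (f : Vector Carrier n) (i : Fin n) →
               (∀ j → j ≢ i → f j ≈ ε) → sum f ≈ f i
  sum-single {suc n} f i vanish = begin
    sum f                     ≈⟨ sum-remove f ⟩
    f i ∙ sum (removeAt f i)  ≈⟨ ∙-congˡ (≈-trans (sum-cong-≋ λ j → vanish _ (punchInᵢ≢i i j))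
                                                 (sum-replicate-zero n)) ⟩
    f i ∙ ε                   ≈⟨ identityʳ (f i) ⟩
    f i                       ∎

  sum-pair : ∀ {n} (P : Fin n → Bool) (f : Vector Carrier n) {i j} → i ≢ j →
             P i ≡ true → P j ≡ true → (∀ k → P k ≡ true → k ≡ i ⊎ k ≡ j) →
             sum (λ k → when (P k) (f k)) ≈ f i ∙ f j
  sum-pair {suc n} P f {i} {j} i≢j Pi Pj onlyij = begin
    sum g                                  ≈⟨ sum-remove g ⟩
    g i ∙ sum (removeAt g i)               ≈⟨ ∙-cong (when-true (f i) Pi) (sum-single (removeAt g i) j′ vanish) ⟩
    f i ∙ g (punchIn i j′)                 ≡⟨ cong (λ k → f i ∙ g k) (punchIn-punchOut i≢j) ⟩
    f i ∙ g j                              ≈⟨ ∙-congˡ (when-true (f j) Pj) ⟩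
    f i ∙ f j                              ∎
    where
    g : Vector Carrier (suc n)
    g k = when (P k) (f k)
    j′ : Fin n
    j′ = punchOut i≢j
    vanish : ∀ k → k ≢ j′ → g (punchIn i k) ≈ ε
    vanish k k≢j′ with P (punchIn i k) in Pk
    ... | false = ≈-refl
    ... | true with onlyij _ Pk
    ...   | inj₁ ≡i = ⊥-elim (punchInᵢ≢i i k ≡i)
    ...   | inj₂ ≡j = ⊥-elim (k≢j′ (punchIn-injective i k j′ (trans ≡j (sym (punchIn-punchOut i≢j)))))

  ∑∑-distrib : ∀ {k m} (f g : Fin k → Fin m → Carrier) →
    ∑[ i < k ] ∑[ j < m ] (f i j ∙ g i j) ≈ (∑[ i < k ] ∑[ j < m ] f i j) ∙ (∑[ i < k ] ∑[ j < m ] g i j)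
  ∑∑-distrib f g = ≈-trans (sum-cong-≋ λ i → ∑-distrib-+ (f i) (g i)) (∑-distrib-+ (λ i → sum (f i)) (λ i → sum (g i)))

  foldr-tabulate : ∀ {a} {A : Set a} {n} (g : A → Carrier → Carrier) (c : A → Carrier) →
                   (∀ y x → g y x ≡ c y ∙ x) → (h : Fin n → A) → ∀ e →
                   foldr g e (tabulate h) ≈ sum (c ∘ h) ∙ e
  foldr-tabulate {n = zero}  g c g≡ h e = ≈-sym (identityˡ e)
  foldr-tabulate {n = suc n} g c g≡ h e = begin
    g (h Fin.zero) (foldr g e (tabulate (h ∘ Fin.suc)))   ≡⟨ g≡ _ _ ⟩
    c (h Fin.zero) ∙ foldr g e (tabulate (h ∘ Fin.suc))   ≈⟨ ∙-congˡ (foldr-tabulate g c g≡ (h ∘ Fin.suc) e) ⟩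
    c (h Fin.zero) ∙ (sum (c ∘ h ∘ Fin.suc) ∙ e)          ≈⟨ ≈-sym (assoc _ _ _) ⟩
    sum (c ∘ h) ∙ e                                      ∎

  sum-× : ∀ {n} (f : Vector ℕ n) x → sum (λ i → f i times x) ≈ ℕ-Sum.sum f times x
  sum-× {zero}  f x = ≈-refl
  sum-× {suc n} f x = ≈-trans (∙-congˡ (sum-× (λ i → f (Fin.suc i)) x)) (≈-sym (×-homo-+ x (f Fin.zero) _))

adjacent⇒≢ : ∀ {n} (S : SignedGraph n) {v w} → Adj S v w → v ≢ w
adjacent⇒≢ S {v} vv refl with trans (sym vv) (adj-irr S v)
... | ()

Adj-sym : ∀ {n} (S : SignedGraph n) {v w} → Adj S v w → Adj S w v
Adj-sym S {v} {w} vw = trans (adj-sym S w v) vw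

module Neighbours {n} (S : SignedGraph n) (tr : TwoRegular S) where

  nb₁ nb₂ : Fin n → Fin n
  nb₁ v = proj₁ (tr v)
  nb₂ v = proj₁ (proj₂ (tr v))

  nb₁≢nb₂ : ∀ v → nb₁ v ≢ nb₂ v
  nb₁≢nb₂ v = proj₁ (proj₂ (proj₂ (tr v)))

  adj-nb₁ : ∀ v → Adj S v (nb₁ v)
  adj-nb₁ v = proj₁ (proj₂ (proj₂ (proj₂ (tr v))))

  adj-nb₂ : ∀ v → Adj S v (nb₂ v)
  adj-nb₂ v = proj₁ (proj₂ (proj₂ (proj₂ (proj₂ (tr v)))))

  neighbour-cases : ∀ v u → Adj S v u → u ≡ nb₁ v ⊎ u ≡ nb₂ v
  neighbour-cases v = proj₂ (proj₂ (proj₂ (proj₂ (proj₂ (tr v)))))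

  other : Fin n → Fin n → Fin n
  other p v = if does (p Fin.≟ nb₁ v) then nb₂ v else nb₁ v

  adj-other : ∀ p v → Adj S v (other p v)
  adj-other p v with p Fin.≟ nb₁ v
  ... | yes _ = adj-nb₂ v
  ... | no  _ = adj-nb₁ v

  other-≢ : ∀ p v → other p v ≢ p
  other-≢ p v with p Fin.≟ nb₁ v
  ... | yes refl = nb₁≢nb₂ v ∘ sym
  ... | no  p≢nb₁ = p≢nb₁ ∘ sym

  other-unique : ∀ {p q v} → Adj S v p → Adj S v q → q ≢ p → other p v ≡ q
  other-unique {p} {q} {v} vp vq q≢p with p Fin.≟ nb₁ v | neighbour-cases v q vq
  ... | yes refl | inj₁ refl   = ⊥-elim (q≢p refl)
  ... | yes refl | inj₂ refl   = refl
  ... | no  p≢nb₁ | inj₁ refl  = refl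
  ... | no  p≢nb₁ | inj₂ refl with neighbour-cases v p vp
  ...   | inj₁ p≡nb₁ = ⊥-elim (p≢nb₁ p≡nb₁)
  ...   | inj₂ refl  = ⊥-elim (q≢p refl)

-- Sums over the edges and incidences of a graph

indicator : Bool → ℕ
indicator b = if b then 1 else 0

edgeCount : ∀ {n} → SignedGraph n → ℕ
edgeCount {n} S = ℕ-Sum.sum λ v → ℕ-Sum.sum λ w → indicator (adj S v w ∧ (toℕ v <ᵇ toℕ w))

module EdgeSums {c ℓ} (M : CommutativeMonoid c ℓ) {n} (S : SignedGraph n) where

  open CommutativeMonoid M renaming (refl to ≈-refl; sym to ≈-sym; trans to ≈-trans)
  open FiniteSums M public
  open import Relation.Binary.Reasoning.Setoid setoid

  precedes : Fin n → Fin n → Bool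
  precedes v w = toℕ v <ᵇ toℕ w

  orderedEdge : Fin n → Fin n → Bool
  orderedEdge v w = adj S v w ∧ precedes v w

  edgeSum : (Fin n → Fin n → Carrier) → Carrier
  edgeSum f = ∑[ v < n ] ∑[ w < n ] when (orderedEdge v w) (f v w)

  incidenceSum : (Fin n → Fin n → Carrier) → Carrier
  incidenceSum f = ∑[ v < n ] ∑[ w < n ] when (adj S v w) (f v w)

  precedes-asym : ∀ {v w} → precedes v w ≡ true → precedes w v ≡ true → ⊥
  precedes-asym {v} {w} v<w w<v =
    <-asym (<ᵇ⇒< (toℕ v) (toℕ w) (Equivalence.from T-≡ v<w)) (<ᵇ⇒< (toℕ w) (toℕ v) (Equivalence.from T-≡ w<v))

  precedes-connex : ∀ {v w} → v ≢ w → precedes v w ≡ false → precedes w v ≡ false → ⊥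
  precedes-connex {v} {w} v≢w v≮w w≮v with <-cmp (toℕ v) (toℕ w)
  ... | tri< v<w _ _ = subst T v≮w (<⇒<ᵇ v<w)
  ... | tri≈ _ v≡w _ = v≢w (toℕ-injective v≡w)
  ... | tri> _ _ w<v = subst T w≮v (<⇒<ᵇ w<v)

  when-split : ∀ v w x → when (adj S v w) x ≈
               when (adj S v w ∧ precedes v w) x ∙ when (adj S w v ∧ precedes w v) x
  when-split v w x rewrite adj-sym S w v
    with adj S v w in vw | precedes v w in v<w | precedes w v in w<v
  ... | false | _     | _     = ≈-sym (identityˡ ε)
  ... | true  | true  | false = ≈-sym (identityʳ x)
  ... | true  | false | true  = ≈-sym (identityˡ x)
  ... | true  | true  | true  = ⊥-elim (precedes-asym {v} {w} v<w w<v)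
  ... | true  | false | false = ⊥-elim (precedes-connex {v} {w} (adjacent⇒≢ S vw) v<w w<v)

  edgeSum-∙ : ∀ f g → edgeSum (λ v w → f v w ∙ g v w) ≈ edgeSum f ∙ edgeSum g
  edgeSum-∙ f g = ≈-trans (sum-cong-≋ λ v → sum-cong-≋ λ w → when-∙ (orderedEdge v w))
                          (∑∑-distrib (λ v w → when (orderedEdge v w) (f v w)) (λ v w → when (orderedEdge v w) (g v w)))
    where
    when-∙ : ∀ {x y} b → when b (x ∙ y) ≈ when b x ∙ when b y
    when-∙ true  = ≈-refl
    when-∙ false = ≈-sym (identityˡ ε)

  edgeSum-cong : ∀ {f g} → (∀ v w → Adj S v w → precedes v w ≡ true → f v w ≈ g v w) →
                 edgeSum f ≈ edgeSum g
  edgeSum-cong {f} {g} f≈g = sum-cong-≋ λ v → sum-cong-≋ λ w → on-edge v w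
    where
    on-edge : ∀ v w → when (adj S v w ∧ precedes v w) (f v w) ≈ when (adj S v w ∧ precedes v w) (g v w)
    on-edge v w with adj S v w in vw | precedes v w in v<w
    ... | true  | true  = f≈g v w vw v<w
    ... | true  | false = ≈-refl
    ... | false | _     = ≈-refl

  incidenceSum-split : ∀ f → incidenceSum f ≈ edgeSum f ∙ edgeSum (λ v w → f w v)
  incidenceSum-split f = begin
    incidenceSum f                               ≈⟨ sum-cong-≋ (λ v → sum-cong-≋ (λ w → when-split v w (f v w))) ⟩
    ∑[ v < n ] ∑[ w < n ] (forward v w ∙ backward v w)  ≈⟨ ∑∑-distrib forward backward ⟩
    edgeSum f ∙ ∑[ v < n ] ∑[ w < n ] backward v w     ≈⟨ ∙-congˡ (∑-comm backward) ⟩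
    edgeSum f ∙ edgeSum (λ v w → f w v)               ∎
    where
    forward backward : Fin n → Fin n → Carrier
    forward  v w = when (orderedEdge v w) (f v w)
    backward v w = when (orderedEdge w v) (f v w)

  private
    sum-ε : ∀ {m} (f : Vector Carrier m) → (∀ i → f i ≈ ε) → sum f ≈ ε
    sum-ε {m} f f≈ε = ≈-trans (sum-cong-≋ f≈ε) (sum-replicate-zero m)

    edgeSum-ordered : ∀ f {x y} → Adj S x y → precedes x y ≡ true →
      (∀ v w → Adj S v w → precedes v w ≡ true → (v , w) ≢ (x , y) → f v w ≈ ε) →
      edgeSum f ≈ f x y
    edgeSum-ordered f {x} {y} xy x<y vanish = begin
      edgeSum f                                          ≈⟨ sum-single _ x (λ v v≢x → sum-ε _ (λ w → off-row v w v≢x)) ⟩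
      ∑[ w < n ] when (adj S x w ∧ precedes x w) (f x w)  ≈⟨ sum-single _ y (λ w w≢y → in-row w w≢y) ⟩
      when (adj S x y ∧ precedes x y) (f x y)            ≡⟨ cong₂ (λ a b → when (a ∧ b) (f x y)) xy x<y ⟩
      f x y                                              ∎
      where
      entry : ∀ v w → (v , w) ≢ (x , y) → when (adj S v w ∧ precedes v w) (f v w) ≈ ε
      entry v w vw≢xy with adj S v w in vw | precedes v w in v<w
      ... | true  | true  = vanish v w vw v<w vw≢xy
      ... | true  | false = ≈-refl
      ... | false | _     = ≈-refl
      off-row : ∀ v w → v ≢ x → when (adj S v w ∧ precedes v w) (f v w) ≈ ε
      off-row v w v≢x = entry v w (v≢x ∘ cong proj₁)
      in-row : ∀ w → w ≢ y → when (adj S x w ∧ precedes x w) (f x w) ≈ ε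
      in-row w w≢y = entry x w (w≢y ∘ cong proj₂)

  edgeSum-edge : ∀ f {x y} → Adj S x y → f x y ≈ f y x →
    (∀ v w → Adj S v w → (v , w) ≢ (x , y) → (v , w) ≢ (y , x) → f v w ≈ ε) →
    edgeSum f ≈ f x y
  edgeSum-edge f {x} {y} xy fxy≈fyx vanish with precedes x y in x<y | precedes y x in y<x
  ... | true  | _     = edgeSum-ordered f xy x<y λ v w vw v<w vw≢xy →
                          vanish v w vw vw≢xy λ { refl → precedes-asym {x} {y} x<y v<w }
  ... | false | true  = ≈-trans (edgeSum-ordered f (Adj-sym S xy) y<x λ v w vw v<w vw≢yx →
                          vanish v w vw (λ { refl → precedes-asym {x} {y} v<w y<x }) vw≢yx)
                          (≈-sym fxy≈fyx)
  ... | false | false = ⊥-elim (precedes-connex {x} {y} (adjacent⇒≢ S xy) x<y y<x)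

  incidenceSum-twoRegular : (tr : TwoRegular S) → ∀ f →
    incidenceSum f ≈ ∑[ v < n ] (f v (Neighbours.nb₁ S tr v) ∙ f v (Neighbours.nb₂ S tr v))
  incidenceSum-twoRegular tr f = sum-cong-≋ λ v →
    sum-pair (adj S v) (f v) (nb₁≢nb₂ v) (adj-nb₁ v) (adj-nb₂ v) (neighbour-cases v)
    where open Neighbours S tr

  edgeSum-const : ∀ x → edgeSum (λ _ _ → x) ≈ edgeCount S times x
  edgeSum-const x = begin
    ∑[ v < n ] ∑[ w < n ] when (orderedEdge v w) x
      ≈⟨ sum-cong-≋ (λ v → sum-cong-≋ (λ w → when-× (orderedEdge v w))) ⟩
    ∑[ v < n ] ∑[ w < n ] (indicator (orderedEdge v w) times x)
      ≈⟨ sum-cong-≋ (λ v → sum-× (λ w → indicator (orderedEdge v w)) x) ⟩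
    ∑[ v < n ] (ℕ-Sum.sum (λ w → indicator (orderedEdge v w)) times x)
      ≈⟨ sum-× (λ v → ℕ-Sum.sum (λ w → indicator (orderedEdge v w))) x ⟩
    edgeCount S times x ∎
    where
    when-× : ∀ b → when b x ≈ indicator b times x
    when-× true  = ≈-sym (×-homo-1 x)
    when-× false = ≈-refl

sum-ones : ∀ n → ℕ-Sum.sum (λ (_ : Fin n) → 1) ≡ n
sum-ones zero    = refl
sum-ones (suc n) = cong suc (sum-ones n)

edgeCount-twoRegular : ∀ {n} {S : SignedGraph n} → TwoRegular S → edgeCount S ≡ n
edgeCount-twoRegular {n} {S} tr = *-cancelˡ-≡ (edgeCount S) n 2 (begin
  2 * edgeCount S                           ≡⟨ cong (edgeCount S +_) (+-identityʳ (edgeCount S)) ⟩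
  edgeCount S + edgeCount S                 ≡⟨ sym (incidenceSum-split (λ _ _ → 1)) ⟩
  incidenceSum (λ _ _ → 1)                  ≡⟨ incidenceSum-twoRegular tr (λ _ _ → 1) ⟩
  ℕ-Sum.sum (λ (_ : Fin n) → 1 + 1)         ≡⟨ ℕ-Sum.∑-distrib-+ {n} (λ _ → 1) (λ _ → 1) ⟩
  ℕ-Sum.sum (λ (_ : Fin n) → 1) + ℕ-Sum.sum (λ (_ : Fin n) → 1) ≡⟨ cong₂ _+_ (sum-ones n) (sum-ones n) ⟩
  n + n                                     ≡⟨ cong (n +_) (sym (+-identityʳ n)) ⟩
  2 * n                                     ∎)
  where
  open EdgeSums +-0-commutativeMonoid S
  open ≡-Reasoning

-- Sign patterns of ±a-colourings

SignPattern : ℕ → Set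
SignPattern n = Fin n → Fin n → Sign

module SignPatterns {n} (S : SignedGraph n) (tr : TwoRegular S) where

  open Neighbours S tr
  open EdgeSums *-commutativeMonoid S

  Alternating : SignPattern n → Set
  Alternating s = ∀ v → s v (nb₁ v) ≡ opposite (s v (nb₂ v))

  -- colour s satisfies the edge condition γ(v,e) = −σ(e)·γ(w,e) exactly when σ = induced s.
  induced : SignPattern n → Fin n → Fin n → Sign
  induced s v w = opposite (s v w · s w v)

  induced-sym : ∀ s v w → induced s v w ≡ induced s w v
  induced-sym s v w = cong opposite (*-comm (s v w) (s w v))

  Induces : SignPattern n → Set
  Induces s = ∀ v w → Adj S v w → σ S v w ≡ induced s v w

  Admissible : SignPattern n → Set
  Admissible s = Alternating s × Induces s

  edgeSum-induced : ∀ s → Alternating s → edgeSum (induced s) ≡ Sign.+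
  edgeSum-induced s alternating = begin
    edgeSum (λ v w → Sign.- · (s v w · s w v))
      ≡⟨ edgeSum-∙ (λ _ _ → Sign.-) (λ v w → s v w · s w v) ⟩
    edgeSum (λ _ _ → Sign.-) · edgeSum (λ v w → s v w · s w v)
      ≡⟨ cong₂ _·_ (edgeSum-const Sign.-) (trans (edgeSum-∙ s (λ v w → s w v)) (sym (incidenceSum-split s))) ⟩
    (edgeCount S times Sign.-) · incidenceSum s
      ≡⟨ cong₂ (λ m x → (m times Sign.-) · x) (edgeCount-twoRegular {S = S} tr)
               (trans (incidenceSum-twoRegular tr s) vertexwise) ⟩
    (n times Sign.-) · ∑[ v < n ] Sign.-
      ≡⟨ cong ((n times Sign.-) ·_) (sum-replicate n) ⟩
    (n times Sign.-) · (n times Sign.-)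
      ≡⟨ s*s≡+ (n times Sign.-) ⟩
    Sign.+ ∎
    where
    open ≡-Reasoning
    vertexwise : ∑[ v < n ] (s v (nb₁ v) · s v (nb₂ v)) ≡ ∑[ v < n ] Sign.-
    vertexwise = sum-cong-≗ λ v → trans (cong (_· s v (nb₂ v)) (alternating v)) (opposite[s]*s≡- (s v (nb₂ v)))

  signProduct≡edgeSum : signProduct S ≡ edgeSum (σ S)
  signProduct≡edgeSum =
    trans (foldr-tabulate _ row (λ v acc → foldr-tabulate _ _ (λ w x → step (orderedEdge v w)) id acc) id Sign.+)
          (*-identityʳ (edgeSum (σ S)))
    where
    row : Fin n → Sign
    row v = ∑[ w < n ] when (orderedEdge v w) (σ S v w)
    step : ∀ {s x} b → (if b then s · x else x) ≡ when b s · x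
    step true  = refl
    step false = refl

  admissible⇒positive : ∀ s → Admissible s → Positive S
  admissible⇒positive s (alternating , induces) = begin
    signProduct S          ≡⟨ signProduct≡edgeSum ⟩
    edgeSum (σ S)          ≡⟨ edgeSum-cong (λ v w vw _ → induces v w vw) ⟩
    edgeSum (induced s)    ≡⟨ edgeSum-induced s alternating ⟩
    Sign.+                 ∎
    where open ≡-Reasoning

  alternating-≢ : ∀ {s} → Alternating s → ∀ {v w₁ w₂} → Adj S v w₁ → Adj S v w₂ → w₁ ≢ w₂ → s v w₁ ≢ s v w₂
  alternating-≢ {s} alternating {v} {w₁} {w₂} vw₁ vw₂ w₁≢w₂
    with neighbour-cases v w₁ vw₁ | neighbour-cases v w₂ vw₂
  ... | inj₁ refl | inj₁ refl = ⊥-elim (w₁≢w₂ refl)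
  ... | inj₂ refl | inj₂ refl = ⊥-elim (w₁≢w₂ refl)
  ... | inj₁ refl | inj₂ refl = λ e → s≢opposite[s] (s v w₂) (trans (sym e) (alternating v))
  ... | inj₂ refl | inj₁ refl = λ e → s≢opposite[s] (s v w₁) (trans e (alternating v))

  oppositePattern : SignPattern n → SignPattern n
  oppositePattern s v w = opposite (s v w)

  admissible-opposite : ∀ s → Admissible s → Admissible (oppositePattern s)
  admissible-opposite s (alternating , induces) =
    (λ v → cong opposite (alternating v)) ,
    (λ v w vw → trans (induces v w vw) (cong opposite (sym (opposite[x]·opposite[y]≡x·y (s v w) (s w v)))))

  module _ {s t : SignPattern n} (s-admissible : Admissible s) (t-admissible : Admissible t) where

    private
      s-alt : Alternating s
      s-alt = proj₁ s-admissible
      s-ind : Induces s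
      s-ind = proj₂ s-admissible
      t-alt : Alternating t
      t-alt = proj₁ t-admissible
      t-ind : Induces t
      t-ind = proj₂ t-admissible

      ratio : Fin n → Sign
      ratio v = t v (nb₁ v) · s v (nb₁ v)

      t≡ratio·s : ∀ v w → Adj S v w → t v w ≡ ratio v · s v w
      t≡ratio·s v w vw with neighbour-cases v w vw
      ... | inj₁ refl = sym ([x·y]·y≡x (t v w) (s v w))
      ... | inj₂ refl = sym (begin
        (t v (nb₁ v) · s v (nb₁ v)) · s v w               ≡⟨ cong₂ (λ x y → (x · y) · s v w) (t-alt v) (s-alt v) ⟩
        (opposite (t v w) · opposite (s v w)) · s v w     ≡⟨ cong (_· s v w) (opposite[x]·opposite[y]≡x·y (t v w) (s v w)) ⟩
        (t v w · s v w) · s v w                           ≡⟨ [x·y]·y≡x (t v w) (s v w) ⟩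
        t v w                                             ∎)
        where open ≡-Reasoning

      ratio-edge : ∀ {v w} → Adj S v w → ratio v ≡ ratio w
      ratio-edge {v} {w} vw = x·y≡[p·x]·[q·y]⇒p≡q (ratio v) (ratio w) (s v w) (s w v) (opposite-injective (begin
        opposite (s v w · s w v)                          ≡⟨ sym (s-ind v w vw) ⟩
        σ S v w                                           ≡⟨ t-ind v w vw ⟩
        opposite (t v w · t w v)
          ≡⟨ cong₂ (λ x y → opposite (x · y)) (t≡ratio·s v w vw) (t≡ratio·s w v (Adj-sym S vw)) ⟩
        opposite ((ratio v · s v w) · (ratio w · s w v))  ∎))
        where open ≡-Reasoning

    admissible-unique : Connected S →
      (∀ v w → Adj S v w → t v w ≡ s v w) ⊎ (∀ v w → Adj S v w → t v w ≡ oppositePattern s v w)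
    admissible-unique (r , conn) = by-ratio (ratio r) refl
      where
      ratio-constant : ∀ v → ratio r ≡ ratio v
      ratio-constant v = fold (λ x y → ratio x ≡ ratio y) trans refl (map ratio-edge (conn r v))

      t≡±s : ∀ {x} → ratio r ≡ x → ∀ v w → Adj S v w → t v w ≡ x · s v w
      t≡±s ratio-r v w vw = trans (t≡ratio·s v w vw) (cong (_· s v w) (trans (sym (ratio-constant v)) ratio-r))

      by-ratio : ∀ x → ratio r ≡ x →
        (∀ v w → Adj S v w → t v w ≡ s v w) ⊎ (∀ v w → Adj S v w → t v w ≡ oppositePattern s v w)
      by-ratio Sign.+ ratio-r = inj₁ (t≡±s ratio-r)
      by-ratio Sign.- ratio-r = inj₂ (t≡±s ratio-r)

module Colourings {n} (S : SignedGraph n) (tr : TwoRegular S) {a : ℤ} (a≢0 : a ≢ 0ℤ) where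

  open Neighbours S tr
  open SignPatterns S tr

  colour : SignPattern n → Coloring n
  colour s v w = s v w ◃c a

  colour-proper : ∀ s → Admissible s → ProperColoring± S a (colour s)
  colour-proper s (alternating , induces) = edge , proper , only±
    where
    edge : IsEdgeColoring S (colour s)
    edge v w vw = trans (cong (_◃c a) (x≡opposite[y·z]⇒y≡opposite[x·z] (σ S v w) (s v w) (s w v) (induces v w vw)))
                        (sym (neg-◃c-◃c (σ S v w) (s w v) a))
    proper : IsProper S (colour s)
    proper v w₁ w₂ vw₁ vw₂ w₁≢w₂ = alternating-≢ {s} alternating vw₁ vw₂ w₁≢w₂ ∘ ◃c-injective a≢0
    only± : UsesOnly± S a (colour s)
    only± v w _ with s v w
    ... | Sign.+ = inj₁ refl
    ... | Sign.- = inj₂ refl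

  signsOf : Coloring n → SignPattern n
  signsOf γ v w = if does (γ v w ℤ.≟ a) then Sign.+ else Sign.-

  colour-signsOf : ∀ {γ} → UsesOnly± S a γ → SameColoring S γ (colour (signsOf γ))
  colour-signsOf {γ} only± v w vw with γ v w ℤ.≟ a | only± v w vw
  ... | yes γ≡a | _        = γ≡a
  ... | no  γ≢a | inj₁ γ≡a = ⊥-elim (γ≢a γ≡a)
  ... | no  _   | inj₂ γ≡-a = γ≡-a

  signsOf-admissible : ∀ {γ} → ProperColoring± S a γ → Admissible (signsOf γ)
  signsOf-admissible {γ} (edge , proper , only±) = alternating , induces
    where
    p : SignPattern n
    p = signsOf γ
    γ≡ : SameColoring S γ (colour p)
    γ≡ = colour-signsOf only±
    alternating : Alternating p
    alternating v = ≢⇒≡opposite λ e → proper v (nb₁ v) (nb₂ v) (adj-nb₁ v) (adj-nb₂ v) (nb₁≢nb₂ v)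
      (trans (γ≡ v (nb₁ v) (adj-nb₁ v)) (trans (cong (_◃c a) e) (sym (γ≡ v (nb₂ v) (adj-nb₂ v)))))
    induces : Induces p
    induces v w vw = x≡opposite[y·z]⇒y≡opposite[x·z] (p v w) (σ S v w) (p w v) (◃c-injective a≢0 (begin
      p v w ◃c a                        ≡⟨ sym (γ≡ v w vw) ⟩
      γ v w                             ≡⟨ edge v w vw ⟩
      - (σ S v w ◃c γ w v)              ≡⟨ cong (λ c → - (σ S v w ◃c c)) (γ≡ w v (Adj-sym S vw)) ⟩
      - (σ S v w ◃c (p w v ◃c a))       ≡⟨ neg-◃c-◃c (σ S v w) (p w v) a ⟩
      opposite (σ S v w · p w v) ◃c a   ∎))
      where open ≡-Reasoning

  colour-opposite-distinct : Fin n → ∀ s → ¬ SameColoring S (colour s) (colour (oppositePattern s))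
  colour-opposite-distinct v s same = s≢opposite[s] (s v (nb₁ v)) (◃c-injective a≢0 (same v (nb₁ v) (adj-nb₁ v)))

  proper-colouring-unique : Connected S → ∀ s → Admissible s → ∀ γ → ProperColoring± S a γ →
                            SameColoring S γ (colour s) ⊎ SameColoring S γ (colour (oppositePattern s))
  proper-colouring-unique connected s admissible γ proper@(_ , _ , only±) =
    [ inj₁ ∘ colour-agrees , inj₂ ∘ colour-agrees ]′
      (admissible-unique {s} {signsOf γ} admissible (signsOf-admissible proper) connected)
    where
    colour-agrees : ∀ {t} → (∀ v w → Adj S v w → signsOf γ v w ≡ t v w) → SameColoring S γ (colour t)
    colour-agrees signs≡ v w vw = trans (colour-signsOf only± v w vw) (cong (_◃c a) (signs≡ v w vw))

-- The walk around a circle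

module Walk {n} (S : SignedGraph n) (tr : TwoRegular S) (connected : Connected S) where

  open Neighbours S tr

  private
    r : Fin n
    r = proj₁ connected
    conn : ∀ x y → Star (Adj S) x y
    conn = proj₂ connected

  walk : ℕ → Fin n
  walk zero                = r
  walk (suc zero)          = nb₁ r
  walk (suc (suc k))       = other (walk k) (walk (suc k))

  step : ∀ k → Adj S (walk k) (walk (suc k))
  step zero    = adj-nb₁ r
  step (suc k) = adj-other (walk k) (walk (suc k))

  no-backtrack : ∀ k → walk (suc (suc k)) ≢ walk k
  no-backtrack k = other-≢ (walk k) (walk (suc k))

  step-back : ∀ k → other (walk (suc (suc k))) (walk (suc k)) ≡ walk k
  step-back k = other-unique (step (suc k)) (Adj-sym S (step k)) (no-backtrack k ∘ sym)

  neighbours-walk : ∀ k {w} → Adj S (walk (suc k)) w → w ≡ walk k ⊎ w ≡ walk (suc (suc k))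
  neighbours-walk k {w} uw with w Fin.≟ walk (suc (suc k))
  ... | yes w≡ = inj₂ w≡
  ... | no  w≢ = inj₁ (trans (sym (other-unique (step (suc k)) uw w≢)) (step-back k))

  record SameDart (i j : ℕ) : Set where
    constructor dart≡
    field
      tail≡ : walk i ≡ walk j
      head≡ : walk (suc i) ≡ walk (suc j)

  open SameDart public

  SameDart-sym : ∀ {i j} → SameDart i j → SameDart j i
  SameDart-sym (dart≡ p q) = dart≡ (sym p) (sym q)

  SameDart-trans : ∀ {i j k} → SameDart i j → SameDart j k → SameDart i k
  SameDart-trans (dart≡ p q) (dart≡ p′ q′) = dart≡ (trans p p′) (trans q q′)

  SameDart-suc : ∀ {i j} → SameDart i j → SameDart (suc i) (suc j)
  SameDart-suc (dart≡ p q) = dart≡ q (cong₂ other p q)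

  SameDart-pred : ∀ {i j} → SameDart (suc i) (suc j) → SameDart i j
  SameDart-pred {i} {j} (dart≡ p q) = dart≡ (trans (sym (step-back i)) (trans (cong₂ other q p) (step-back j))) p

  SameDart-shift : ∀ i d → SameDart i (i + d) → SameDart 0 d
  SameDart-shift zero    d same = same
  SameDart-shift (suc i) d same = SameDart-shift i d (SameDart-pred same)

  SameDart? : ∀ i j → Dec (SameDart i j)
  SameDart? i j = map′ (λ (p , q) → dart≡ p q) (λ d → tail≡ d , head≡ d)
                            ((walk i Fin.≟ walk j) ×-dec (walk (suc i) Fin.≟ walk (suc j)))

  some-period : ∃ λ d → SameDart 0 (suc d)
  some-period with pigeonhole (n<1+n (n * n)) (λ (i : Fin (suc (n * n))) → combine (walk (toℕ i)) (walk (suc (toℕ i))))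
  ... | i , j , i<j , same = d , SameDart-shift (toℕ i) (suc d)
    (subst (SameDart (toℕ i)) (sym j≡i+suc[d]) (uncurry dart≡ (combine-injective _ _ _ _ same)))
    where
    d : ℕ
    d = toℕ j ∸ suc (toℕ i)
    j≡i+suc[d] : toℕ i + suc d ≡ toℕ j
    j≡i+suc[d] = trans (+-suc (toℕ i) d) (m+[n∸m]≡n i<j)

  -- abstract, so that type checking never tries to evaluate the search for the period.
  abstract
    shortest : Σ ℕ λ d → SameDart 0 (suc d) × (∀ {j} → j < d → ¬ SameDart 0 (suc j))
    shortest = minimal-witness (λ d → SameDart? 0 (suc d)) (proj₂ some-period)

  last : ℕ
  last = proj₁ shortest

  period : ℕ
  period = suc last

  closes : SameDart 0 period
  closes = proj₁ (proj₂ shortest)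

  minimal : ∀ {j} → j < last → ¬ SameDart 0 (suc j)
  minimal = proj₂ (proj₂ shortest)

  SameDart-+period : ∀ i → SameDart i (i + period)
  SameDart-+period zero    = closes
  SameDart-+period (suc i) = SameDart-suc (SameDart-+period i)

  wraps : ∀ k → SameDart k (suc (k + last))
  wraps k = subst (SameDart k) (+-suc k last) (SameDart-+period k)

  SameDart-+multiple : ∀ j t → SameDart j (j + t * period)
  SameDart-+multiple j zero    = subst (SameDart j) (sym (+-identityʳ j)) (dart≡ refl refl)
  SameDart-+multiple j (suc t) = SameDart-trans (SameDart-+multiple j t)
    (subst (SameDart (j + t * period))
           (trans (+-assoc j (t * period) period) (cong (j +_) (+-comm (t * period) period)))
           (SameDart-+period (j + t * period)))

  mod-period≤last : ∀ k → k % period ≤ last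
  mod-period≤last k = ≤-pred (m%n<n k period)

  SameDart-mod : ∀ k → SameDart (k % period) k
  SameDart-mod k = subst (SameDart (k % period)) (sym (m≡m%n+[m/n]*n k period))
                         (SameDart-+multiple (k % period) (k / period))

  record Reversed (l m : ℕ) : Set where
    constructor reversed
    field
      tail≡head : walk l ≡ walk (suc m)
      head≡tail : walk (suc l) ≡ walk m

  Reversed-inward : ∀ {l m} → Reversed l (suc m) → Reversed (suc l) m
  Reversed-inward {l} {m} (reversed p q) = reversed q (trans (cong₂ other p q) (step-back m))

  ¬Reversed : ∀ l j → ¬ Reversed l (l + j)
  ¬Reversed l zero          (reversed p _) = adjacent⇒≢ S (step l) (trans p (cong (walk ∘ suc) (+-identityʳ l)))
  ¬Reversed l (suc zero)    (reversed p _) = no-backtrack l (sym (trans p (cong (walk ∘ suc) (+-comm l 1))))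
  ¬Reversed l (suc (suc j)) rev     = ¬Reversed (suc l) j
    (subst (Reversed (suc l)) (+-suc l j) (Reversed-inward (subst (Reversed l) (+-suc l (suc j)) rev)))

  -- If walk k = walk l, then walk (1 + l) is a neighbour of walk k = walk (1 + k + last): either the walk
  -- repeats a dart within a shorter period, or it retraces itself backwards, which forces a backtrack.
  walk-injective-< : ∀ {k l} → k < l → l ≤ last → walk k ≢ walk l
  walk-injective-< {k} {l} k<l l≤last uk≡ul =
    [ reversal , repetition ]′ (neighbours-walk m (subst (λ x → Adj S x (walk (suc l))) ul≡u[1+m] (step l)))
    where
    m : ℕ
    m = k + last
    ul≡u[1+m] : walk l ≡ walk (suc m)
    ul≡u[1+m] = trans (sym uk≡ul) (tail≡ (wraps k))

    reversal : walk (suc l) ≡ walk m → ⊥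
    reversal backwards =
      ¬Reversed l (m ∸ l) (subst (Reversed l) (sym (m+[n∸m]≡n l≤m)) (reversed ul≡u[1+m] backwards))
      where
      l≤m : l ≤ m
      l≤m = ≤-trans l≤last (m≤n+m last k)

    repetition : walk (suc l) ≡ walk (suc (suc m)) → ⊥
    repetition forward = minimal d<last (SameDart-shift k (suc d) (subst (SameDart k) (sym l≡k+suc[d]) same))
      where
      d : ℕ
      d = l ∸ suc k
      l≡k+suc[d] : k + suc d ≡ l
      l≡k+suc[d] = trans (+-suc k d) (m+[n∸m]≡n k<l)
      d<last : d < last
      d<last = ≤-trans (s≤s (m≤n+m d k)) (≤-trans (≤-reflexive (trans (sym (+-suc k d)) l≡k+suc[d])) l≤last)
      same : SameDart k l
      same = SameDart-trans (wraps k) (SameDart-sym (dart≡ ul≡u[1+m] forward))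

  walk-injective : ∀ {k l} → k ≤ last → l ≤ last → walk k ≡ walk l → k ≡ l
  walk-injective {k} {l} k≤last l≤last uk≡ul with <-cmp k l
  ... | tri< k<l _ _ = ⊥-elim (walk-injective-< k<l l≤last uk≡ul)
  ... | tri≈ _ k≡l _ = k≡l
  ... | tri> _ _ l<k = ⊥-elim (walk-injective-< l<k k≤last (sym uk≡ul))

  reachable : ∀ v → ∃ λ k → walk (suc k) ≡ v
  reachable v = fold (λ x y → (∃ λ k → walk (suc k) ≡ x) → ∃ λ k → walk (suc k) ≡ y) (λ f g → g ∘ f) id
                     (map extend (conn r v)) (last , sym (tail≡ closes))
    where
    extend : ∀ {x y} → Adj S x y → (∃ λ k → walk (suc k) ≡ x) → ∃ λ k → walk (suc k) ≡ y
    extend xy (k , refl) with neighbours-walk k xy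
    ... | inj₁ y≡uk     = k + last , trans (sym (tail≡ (wraps k))) (sym y≡uk)
    ... | inj₂ y≡u[2+k] = suc k , sym y≡u[2+k]

  locate : ∀ v → ∃ λ k → k ≤ last × walk k ≡ v
  locate v = k % period , mod-period≤last k , trans (tail≡ (SameDart-mod k)) uk≡v
    where
    k : ℕ
    k = suc (proj₁ (reachable v))
    uk≡v : walk k ≡ v
    uk≡v = proj₂ (reachable v)

  position : Fin n → ℕ
  position v = proj₁ (locate v)

  position≤last : ∀ v → position v ≤ last
  position≤last v = proj₁ (proj₂ (locate v))

  walk-position : ∀ v → walk (position v) ≡ v
  walk-position v = proj₂ (proj₂ (locate v))

  position-walk : ∀ {k} → k ≤ last → position (walk k) ≡ k
  position-walk {k} k≤last = walk-injective (position≤last (walk k)) k≤last (walk-position (walk k))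

  next : Fin n → Fin n
  next v = walk (suc (position v))

  next-walk : ∀ k → next (walk k) ≡ walk (suc k)
  next-walk k = trans (cong (walk ∘ suc) position≡) (head≡ (SameDart-mod k))
    where
    position≡ : position (walk k) ≡ k % period
    position≡ = walk-injective (position≤last (walk k)) (mod-period≤last k)
                  (trans (walk-position (walk k)) (sym (tail≡ (SameDart-mod k))))

module CyclePattern {n} (S : SignedGraph n) (tr : TwoRegular S) (connected : Connected S) where

  open Neighbours S tr
  open Walk S tr connected
  open SignPatterns S tr
  open EdgeSums *-commutativeMonoid S

  holonomy : ℕ → Sign
  holonomy zero    = Sign.+
  holonomy (suc k) = σ S (walk k) (walk (suc k)) · holonomy k

  -- The sign leaving v along the walk is the holonomy up to v, so the edge condition holds along the walk.
  cyclePattern : SignPattern n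
  cyclePattern v w = if does (w Fin.≟ next v) then holonomy (position v) else opposite (holonomy (position v))

  private
    s : SignPattern n
    s = cyclePattern

  cyclePattern-alternating : Alternating cyclePattern
  cyclePattern-alternating v with nb₁ v Fin.≟ next v | nb₂ v Fin.≟ next v
  ... | yes nb₁≡ | yes nb₂≡ = ⊥-elim (nb₁≢nb₂ v (trans nb₁≡ (sym nb₂≡)))
  ... | yes _    | no  _    = sym (opposite-involutive (holonomy (position v)))
  ... | no  _    | yes _    = refl
  ... | no  nb₁≢ | no  nb₂≢
    with neighbour-cases v (next v) (subst (λ x → Adj S x (next v)) (walk-position v) (step (position v)))
  ...   | inj₁ next≡nb₁ = ⊥-elim (nb₁≢ (sym next≡nb₁))
  ...   | inj₂ next≡nb₂ = ⊥-elim (nb₂≢ (sym next≡nb₂))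

  induced-step : ∀ k →
    induced s (walk k) (walk (suc k)) ≡ holonomy (position (walk k)) · holonomy (position (walk (suc k)))
  induced-step k = trans (cong₂ (λ x y → opposite (x · y)) forward-sign backward-sign)
    (opposite[x·opposite[y]]≡x·y (holonomy (position (walk k))) (holonomy (position (walk (suc k)))))
    where
    forward-sign : s (walk k) (walk (suc k)) ≡ holonomy (position (walk k))
    forward-sign with walk (suc k) Fin.≟ next (walk k)
    ... | yes _ = refl
    ... | no  ≢next = ⊥-elim (≢next (sym (next-walk k)))
    backward-sign : s (walk (suc k)) (walk k) ≡ opposite (holonomy (position (walk (suc k))))
    backward-sign with walk k Fin.≟ next (walk (suc k))
    ... | yes ≡next = ⊥-elim (no-backtrack k (sym (trans ≡next (next-walk (suc k)))))
    ... | no  _     = refl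

  inner-edge : ∀ {k} → k < last → induced s (walk k) (walk (suc k)) ≡ σ S (walk k) (walk (suc k))
  inner-edge {k} k<last = begin
    induced s (walk k) (walk (suc k))
      ≡⟨ induced-step k ⟩
    holonomy (position (walk k)) · holonomy (position (walk (suc k)))
      ≡⟨ cong₂ (λ i j → holonomy i · holonomy j) (position-walk (<⇒≤ k<last)) (position-walk k<last) ⟩
    holonomy k · (σ S (walk k) (walk (suc k)) · holonomy k)
      ≡⟨ cong (holonomy k ·_) (*-comm (σ S (walk k) (walk (suc k))) (holonomy k)) ⟩
    holonomy k · (holonomy k · σ S (walk k) (walk (suc k)))
      ≡⟨ y·[y·x]≡x (σ S (walk k) (walk (suc k))) (holonomy k) ⟩
    σ S (walk k) (walk (suc k))
      ∎
    where open ≡-Reasoning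

  closing-edge : induced s (walk last) (walk period) ≡ σ S (walk last) (walk period) · holonomy period
  closing-edge = begin
    induced s (walk last) (walk period)
      ≡⟨ induced-step last ⟩
    holonomy (position (walk last)) · holonomy (position (walk period))
      ≡⟨ cong₂ (λ i j → holonomy i · holonomy j) (position-walk ≤-refl) position-walk[period] ⟩
    holonomy last · Sign.+
      ≡⟨ *-identityʳ (holonomy last) ⟩
    holonomy last
      ≡⟨ sym (y·[y·x]≡x (holonomy last) (σ S (walk last) (walk period))) ⟩
    σ S (walk last) (walk period) · holonomy period
      ∎
    where
    open ≡-Reasoning
    position-walk[period] : position (walk period) ≡ 0
    position-walk[period] = trans (cong position (sym (tail≡ closes))) (position-walk z≤n)

  Closing : Fin n → Fin n → Set
  Closing v w = (v , w) ≡ (walk last , walk period) ⊎ (v , w) ≡ (walk period , walk last)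

  ClosingOrFaithful : Fin n → Fin n → Set
  ClosingOrFaithful v w = Closing v w ⊎ induced s v w ≡ σ S v w

  closingOrFaithful-dart : ∀ {k j} → k ≤ last → SameDart k j → ClosingOrFaithful (walk j) (walk (suc j))
  closingOrFaithful-dart k≤last (dart≡ t h) with m≤n⇒m<n∨m≡n k≤last
  ... | inj₁ k<last = inj₂ (subst₂ (λ x y → induced s x y ≡ σ S x y) t h (inner-edge k<last))
  ... | inj₂ refl   = inj₁ (inj₁ (cong₂ _,_ (sym t) (sym h)))

  closingOrFaithful-sym : ∀ {v w} → ClosingOrFaithful w v → ClosingOrFaithful v w
  closingOrFaithful-sym (inj₁ (inj₁ refl))   = inj₁ (inj₂ refl)
  closingOrFaithful-sym (inj₁ (inj₂ refl))   = inj₁ (inj₁ refl)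
  closingOrFaithful-sym {v} {w} (inj₂ faithful) = inj₂ (trans (induced-sym s v w) (trans faithful (σ-sym S w v)))

  closingOrFaithful-after : ∀ j {w} → Adj S (walk (suc j)) w → ClosingOrFaithful (walk (suc j)) w
  closingOrFaithful-after j uw with neighbours-walk j uw
  ... | inj₁ refl = closingOrFaithful-sym {walk (suc j)} {walk j}
                      (closingOrFaithful-dart (mod-period≤last j) (SameDart-mod j))
  ... | inj₂ refl = closingOrFaithful-dart (mod-period≤last (suc j)) (SameDart-mod (suc j))

  closingOrFaithful : ∀ v w → Adj S v w → ClosingOrFaithful v w
  closingOrFaithful v w vw =
    subst (λ x → ClosingOrFaithful x w) u≡v (closingOrFaithful-after j (subst (λ x → Adj S x w) (sym u≡v) vw))
    where
    j : ℕ
    j = proj₁ (reachable v)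
    u≡v : walk (suc j) ≡ v
    u≡v = proj₂ (reachable v)

  discrepancy : Fin n → Fin n → Sign
  discrepancy v w = σ S v w · induced s v w

  discrepancy-closing : discrepancy (walk last) (walk period) ≡ holonomy period
  discrepancy-closing = trans (cong (σ S (walk last) (walk period) ·_) closing-edge)
                              (y·[y·x]≡x (holonomy period) (σ S (walk last) (walk period)))

  discrepancy-sym : ∀ v w → discrepancy v w ≡ discrepancy w v
  discrepancy-sym v w = cong₂ _·_ (σ-sym S v w) (induced-sym s v w)

  discrepancy-off-closing : ∀ v w → Adj S v w →
    (v , w) ≢ (walk last , walk period) → (v , w) ≢ (walk period , walk last) → discrepancy v w ≡ Sign.+
  discrepancy-off-closing v w vw ≢xy ≢yx with closingOrFaithful v w vw
  ... | inj₁ (inj₁ ≡xy) = ⊥-elim (≢xy ≡xy)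
  ... | inj₁ (inj₂ ≡yx) = ⊥-elim (≢yx ≡yx)
  ... | inj₂ faithful   = trans (cong (σ S v w ·_) faithful) (s*s≡+ (σ S v w))

  holonomy-period : Positive S → holonomy period ≡ Sign.+
  holonomy-period positive = begin
    holonomy period
      ≡⟨ sym discrepancy-closing ⟩
    discrepancy (walk last) (walk period)
      ≡⟨ sym (edgeSum-edge discrepancy (step last) (discrepancy-sym _ _) discrepancy-off-closing) ⟩
    edgeSum discrepancy
      ≡⟨ edgeSum-∙ (σ S) (induced s) ⟩
    edgeSum (σ S) · edgeSum (induced s)
      ≡⟨ cong₂ _·_ (trans (sym signProduct≡edgeSum) positive) (edgeSum-induced s cyclePattern-alternating) ⟩
    Sign.+
      ∎
    where open ≡-Reasoning

  cyclePattern-admissible : Positive S → Admissible cyclePattern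
  cyclePattern-admissible positive = cyclePattern-alternating , λ v w vw → induces (closingOrFaithful v w vw)
    where
    closing-induces : σ S (walk last) (walk period) ≡ induced s (walk last) (walk period)
    closing-induces = sym (trans closing-edge (trans (cong (σ S (walk last) (walk period) ·_) (holonomy-period positive))
                                                     (*-identityʳ _)))
    induces : ∀ {v w} → ClosingOrFaithful v w → σ S v w ≡ induced s v w
    induces (inj₁ (inj₁ refl)) = closing-induces
    induces (inj₁ (inj₂ refl)) =
      trans (σ-sym S (walk period) (walk last)) (trans closing-induces (induced-sym s (walk last) (walk period)))
    induces (inj₂ faithful)    = sym faithful

mainTheorem10 : ∀ {n : ℕ} (C : SignedGraph n) → IsCircle C → (a : ℤ) → a ≢ 0ℤ →
    ((Σ (Coloring n) λ γ → ProperColoring± C a γ) ⇔ Positive C)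
    × (Positive C → ExactlyTwo± C a)
mainTheorem10 C (connected , tr) a a≢0 = mk⇔ colouring⇒positive positive⇒colouring , exactlyTwo
  where
  open SignPatterns C tr
  open Colourings C tr a≢0
  open CyclePattern C tr connected

  colouring⇒positive : (Σ (Coloring _) λ γ → ProperColoring± C a γ) → Positive C
  colouring⇒positive (γ , proper) = admissible⇒positive (signsOf γ) (signsOf-admissible proper)

  positive⇒colouring : Positive C → Σ (Coloring _) λ γ → ProperColoring± C a γ
  positive⇒colouring positive = colour cyclePattern , colour-proper cyclePattern (cyclePattern-admissible positive)

  exactlyTwo : Positive C → ExactlyTwo± C a
  exactlyTwo positive =
    colour cyclePattern , colour (oppositePattern cyclePattern) ,
    colour-proper cyclePattern admissible ,
    colour-proper (oppositePattern cyclePattern) (admissible-opposite cyclePattern admissible) ,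
    colour-opposite-distinct (proj₁ connected) cyclePattern ,
    proper-colouring-unique connected cyclePattern admissible
    where
    admissible : Admissible cyclePattern
    admissible = cyclePattern-admissible positive
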